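{- Let $n,\alpha,\beta\ge1$ be integers and let $u=C(n,\alpha)\in\{a<z\}^n$ and $v=C(n,\beta)\in\{b<z\}^n$ be Christoffel words. There exist positive integers $x,y$ such that $\alpha x+\beta y=n$ if and only if $u$ and $\widetilde v$ are perfectly superimposable.
   Context: For coprime $s,t\in\{0,1,2,\dots\}$ and $n=s+t$, the Christoffel word over the ordered alphabet $\{a<z\}$ with $s$ occurrences of $a$ and $t$ occurrences of $z$ is $u=u[0]u[1]\cdots u[n-1]$ with $u[i]=a$ if $((i+1)t \bmod n)>(it\bmod n)$ and $u[i]=z$ otherwise. It is denoted $C(n,s)$; calling $C(n,s)$ a Christoffel word presupposes $\gcd(n,s)=1$. Over $\{b<z\}$ the definition is the same with $b$ in place of $a$. $\widetilde v$ denotes the reversal (mirror image) of $v$. Two words $u\in\{a,z\}^n$ and $v'\in\{b,z\}^n$ of the same length are perfectly superimposable if no position carries the letter $a$ in $u$ and the letter $b$ in $v'$.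
   Formalization: For n = 1 the letter formula gives C(1,1) = z, contradicting its one occurrence of a and making the claim false at n = α = β = 1; here C(1,1) is taken to be the single smaller letter (a, respectively b), as the letter counts require. -}

module Defs where

open import Data.Bool using (if_then_else_)
open import Data.Fin using (Fin; toℕ)
open import Data.Nat using (ℕ; zero; suc; _*_; _∸_; _<?_; NonZero)
open import Data.Nat.DivMod using (_%_)
open import Data.Product using (_×_)
open import Data.Vec using (Vec; lookup; tabulate)
open import Relation.Binary.PropositionalEquality using (_≡_)
open import Relation.Nullary using (¬_; does)

data AZ : Set where
  a z : AZ

data BZ : Set where
  b z : BZ

module _ {A : Set} (lo hi : A) where

  -- The i-th letter, where n = s + t.  The word must contain s letters lo
  -- and t letters hi.  The formula comparing residues achieves this for every
  -- coprime pair (s , t) except (1 , 0), where n = 1 and 0 < 0 fails, so that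
  -- it would give hi instead of lo.  For coprime (s , t) the clause t = 0 is
  -- exactly this case, and makes the word the single letter lo.
  christoffelLetter : (n t : ℕ) .{{_ : NonZero n}} → ℕ → A
  christoffelLetter n zero      i = lo
  christoffelLetter n t@(suc _) i =
    if does (((i * t) % n) <? ((suc i * t) % n)) then lo else hi

  -- C(n , s) over the alphabet {lo < hi}.  It is a Christoffel word only when
  -- s ≤ n (so that n ∸ s is the true difference) and n, s are coprime.
  christoffel : (n s : ℕ) .{{_ : NonZero n}} → Vec A n
  christoffel n s = tabulate λ i → christoffelLetter n (n ∸ s) (toℕ i)

PerfectlySuperimposable : ∀ {n} → Vec AZ n → Vec BZ n → Set
PerfectlySuperimposable {n} u v =
  (i : Fin n) → ¬ (lookup u i ≡ a × lookup v i ≡ b)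

{-# OPTIONS --safe #-}
-- The lower letter sits at position i of C(n , s) exactly when − i s is
-- congruent mod n to some r < s.  Position i of u and position n − 1 − i of v
-- therefore collide iff − i α ≡ r and (i + 1) β ≡ q for some r < α and q < β.
-- Multiplying by β and by α and putting p = β − q, a collision exists iff
-- p α ≡ r β (mod n) for some 1 ≤ p ≤ β and 0 ≤ r < α.
-- If n = α x + β y with x , y > 0, then α and β are coprime, and such a
-- congruence forces p > β or r ≥ α.  Conversely, if α and β have a common
-- divisor d > 1, take p = β / d and r = α / d; otherwise write n = α x + β y
-- with 1 ≤ x ≤ β, where y ≤ 0 gives the collision p = x, r = − y.
module Submission where

open import Defs
open import Data.Nat using (ℕ; _+_; _*_; _≤_; _>_; NonZero)
open import Data.Nat.Coprimality using (Coprime)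
open import Data.Product using (∃-syntax; _×_)
open import Data.Vec using (reverse)
open import Function.Bundles using (_⇔_)
open import Relation.Binary.PropositionalEquality using (_≡_)

open import Data.Bool using (if_then_else_)
open import Data.Empty using (⊥)
open import Data.Fin as Fin using (Fin; toℕ; fromℕ; fromℕ<; inject₁; opposite)
open import Data.Fin.Properties using (opposite-involutive; opposite-prop; toℕ-fromℕ<; toℕ<n)
open import Data.Nat using (zero; suc; pred; _∸_; _<_; _<?_; z≤n; s≤s; >-nonZero⁻¹)
open import Data.Nat.Coprimality as Coprimality using (coprime?; coprime-Bézout; coprime-divisor; gcd≡1⇒coprime)
open import Data.Nat.Divisibility using (_∣_; divides; ∣-trans; ∣m+n∣m⇒∣n; ∣m∣n⇒∣m+n; n∣m*n; m∣m*n)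
open import Data.Nat.DivMod using (_%_; _/_; m≡m%n+[m/n]*n; m%n<n; m<n⇒m%n≡m; [m+kn]%n≡m%n; [m+n]%n≡m%n; %-distribˡ-+; m%n%n≡m%n)
open import Data.Nat.GCD using (gcd[m,n]∣m; gcd[m,n]∣n; module Bézout)
open import Data.Nat.Properties
open import Data.Nat.Tactic.RingSolver using (solve-∀)
open import Data.Product using (_,_; proj₁; proj₂)
open import Data.Sum using (_⊎_; inj₁; inj₂)
open import Data.Vec using (Vec; []; _∷_; _∷ʳ_; lookup)
open import Data.Vec.Properties using (lookup∘tabulate; reverse-∷)
open import Function.Base using (_∘_)
open import Function.Bundles using (mk⇔; module Equivalence)
open import Relation.Binary.PropositionalEquality using (_≢_; refl; sym; trans; cong; cong₂; subst; module ≡-Reasoning)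
open import Relation.Nullary using (Dec; does; yes; no; contradiction)
open import Relation.Nullary.Decidable using (dec-true)

private
  variable
    A : Set
    n : ℕ

-- Mirror positions in a reversed vector.

lookup-∷ʳ-fromℕ : (xs : Vec A n) (x : A) → lookup (xs ∷ʳ x) (fromℕ n) ≡ x
lookup-∷ʳ-fromℕ []       x = refl
lookup-∷ʳ-fromℕ (_ ∷ xs) x = lookup-∷ʳ-fromℕ xs x

lookup-∷ʳ-inject₁ : (xs : Vec A n) (x : A) (i : Fin n) →
  lookup (xs ∷ʳ x) (inject₁ i) ≡ lookup xs i
lookup-∷ʳ-inject₁ (_ ∷ xs) x Fin.zero    = refl
lookup-∷ʳ-inject₁ (_ ∷ xs) x (Fin.suc i) = lookup-∷ʳ-inject₁ xs x i

-- Having `opposite` on the reversed side makes the induction compute: the head becomes the appended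
-- entry, at `fromℕ`, and a later position goes through `inject₁`.
lookup-reverse-opposite : (xs : Vec A n) (i : Fin n) →
  lookup (reverse xs) (opposite i) ≡ lookup xs i
lookup-reverse-opposite (x ∷ xs) i rewrite reverse-∷ x xs with i
... | Fin.zero  = lookup-∷ʳ-fromℕ (reverse xs) x
... | Fin.suc j = trans (lookup-∷ʳ-inject₁ (reverse xs) x (opposite j)) (lookup-reverse-opposite xs j)

lookup-reverse : (xs : Vec A n) (i : Fin n) → lookup (reverse xs) i ≡ lookup xs (opposite i)
lookup-reverse xs i = subst (λ k → lookup (reverse xs) k ≡ lookup xs (opposite i))
  (opposite-involutive i) (lookup-reverse-opposite xs (opposite i))

suc[i+opposite[i]]≡n : (i : Fin n) → suc (toℕ i + toℕ (opposite i)) ≡ n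
suc[i+opposite[i]]≡n i = trans (cong (λ k → suc (toℕ i + k)) (opposite-prop i)) (m+[n∸m]≡n (toℕ<n i))

-- Letters of a Christoffel word as residues.

-- − c is congruent mod n to some r < s.
NegResidue : (n s c : ℕ) → Set
NegResidue n s c = ∃[ r ] (r < s × n ∣ c + r)

module _ {s t n : ℕ} .{{_ : NonZero n}} (s+t≡n : s + t ≡ n) where

  private
    suc-step : ∀ i → (suc i * t) % n ≡ (t + (i * t) % n) % n
    suc-step i = begin
      (t + i * t) % n                ≡⟨ %-distribˡ-+ t (i * t) n ⟩
      (t % n + (i * t) % n) % n      ≡⟨ cong (λ k → (t % n + k) % n) (m%n%n≡m%n (i * t) n) ⟨
      (t % n + (i * t) % n % n) % n  ≡⟨ %-distribˡ-+ t ((i * t) % n) n ⟨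
      (t + (i * t) % n) % n          ∎
      where open ≡-Reasoning

    -- A residue below `s` plus `t` stays below `s + t = n`, so nothing is reduced.
    step-of-small : ∀ i → (i * t) % n < s → (suc i * t) % n ≡ t + (i * t) % n
    step-of-small i ρ<s = trans (suc-step i) (m<n⇒m%n≡m
      (subst (t + (i * t) % n <_) (trans (+-comm t s) s+t≡n) (+-monoʳ-< t ρ<s)))

  -- If the residue `ρ` is at least `s`, then adding `t` reaches `n` and wraps around to `ρ - s`,
  -- which is no ascent.
  ascent⇒small : ∀ i → (i * t) % n < (suc i * t) % n → (i * t) % n < s
  ascent⇒small i asc with (i * t) % n <? s
  ... | yes ρ<s = ρ<s
  ... | no  ρ≮s = contradiction asc (≤⇒≯ (≤-trans (≤-reflexive step) (m∸n≤m ρ s)))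
    where
    ρ = (i * t) % n
    e = ρ ∸ s
    t+ρ≡e+n : t + ρ ≡ e + n
    t+ρ≡e+n = begin
      t + ρ        ≡⟨ cong (t +_) (m+[n∸m]≡n (≮⇒≥ ρ≮s)) ⟨
      t + (s + e)  ≡⟨ regroup t s e ⟩
      e + (s + t)  ≡⟨ cong (e +_) s+t≡n ⟩
      e + n        ∎
      where
      open ≡-Reasoning
      regroup : ∀ t s e → t + (s + e) ≡ e + (s + t)
      regroup = solve-∀
    step : (suc i * t) % n ≡ e
    step = begin
      (suc i * t) % n  ≡⟨ suc-step i ⟩
      (t + ρ) % n      ≡⟨ cong (_% n) t+ρ≡e+n ⟩
      (e + n) % n      ≡⟨ [m+n]%n≡m%n e n ⟩
      e % n            ≡⟨ m<n⇒m%n≡m (≤-<-trans (m∸n≤m ρ s) (m%n<n (i * t) n)) ⟩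
      e                ∎
      where open ≡-Reasoning

  small⇒ascent : 0 < t → ∀ i → (i * t) % n < s → (i * t) % n < (suc i * t) % n
  small⇒ascent 0<t i ρ<s = subst ((i * t) % n <_) (sym (step-of-small i ρ<s)) (+-monoˡ-< ((i * t) % n) 0<t)

  -- As `s + t = n`, the products `i * t` and `- i * s` agree mod `n`, so the residue of `i * t` is
  -- itself the witness.
  small⇒negResidue : ∀ i → (i * t) % n < s → NegResidue n s (i * s)
  small⇒negResidue i ρ<s = ρ , ρ<s , ∣m+n∣m⇒∣n (divides i total) (n∣m*n ((i * t) / n))
    where
    ρ = (i * t) % n
    k = (i * t) / n
    regroup : ∀ k n i s ρ → k * n + (i * s + ρ) ≡ i * s + (ρ + k * n)
    regroup = solve-∀
    total : k * n + (i * s + ρ) ≡ i * n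
    total = begin
      k * n + (i * s + ρ)  ≡⟨ regroup k n i s ρ ⟩
      i * s + (ρ + k * n)  ≡⟨ cong (i * s +_) (m≡m%n+[m/n]*n (i * t) n) ⟨
      i * s + i * t        ≡⟨ *-distribˡ-+ i s t ⟨
      i * (s + t)          ≡⟨ cong (i *_) s+t≡n ⟩
      i * n                ∎
      where open ≡-Reasoning

  negResidue⇒small : ∀ i → NegResidue n s (i * s) → (i * t) % n < s
  negResidue⇒small i (r , r<s , divides k is+r≡kn) = subst (_< s) (sym it%n≡r) r<s
    where
    open ≡-Reasoning
    regroup : ∀ i s t r → i * t + (i * s + r) ≡ r + i * (s + t)
    regroup = solve-∀
    it%n≡r : (i * t) % n ≡ r
    it%n≡r = begin
      (i * t) % n                ≡⟨ [m+kn]%n≡m%n (i * t) k n ⟨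
      (i * t + k * n) % n        ≡⟨ cong (λ m → (i * t + m) % n) is+r≡kn ⟨
      (i * t + (i * s + r)) % n  ≡⟨ cong (_% n) (regroup i s t r) ⟩
      (r + i * (s + t)) % n      ≡⟨ cong (λ m → (r + i * m) % n) s+t≡n ⟩
      (r + i * n) % n            ≡⟨ [m+kn]%n≡m%n r i n ⟩
      r % n                      ≡⟨ m<n⇒m%n≡m (<-≤-trans r<s (subst (s ≤_) s+t≡n (m≤m+n s t))) ⟩
      r                          ∎

if-does≡then⇒ : {P : Set} {x y : A} → x ≢ y → (P? : Dec P) → (if does P? then x else y) ≡ x → P
if-does≡then⇒ _   (yes p) _   = p
if-does≡then⇒ x≢y (no _)  y≡x = contradiction (sym y≡x) x≢y

if-does≡then⇐ : {P : Set} {x y : A} (P? : Dec P) → P → (if does P? then x else y) ≡ x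
if-does≡then⇐ P? p rewrite dec-true P? p = refl

module _ {lo hi : A} (lo≢hi : lo ≢ hi) {s : ℕ} (0<s : 0 < s) .{{_ : NonZero n}} where

  private
    letter : (t : ℕ) → s + t ≡ n → ∀ i →
      christoffelLetter lo hi n t i ≡ lo ⇔ NegResidue n s (i * s)
    -- Here `s = n`, so every `i * s` is a multiple of `n` and residue 0 serves at each position, in
    -- accordance with the constant word.
    letter zero s+0≡n i = mk⇔ (λ _ → 0 , 0<s , divides i is+0≡in) (λ _ → refl)
      where
      is+0≡in : i * s + 0 ≡ i * n
      is+0≡in = trans (+-identityʳ (i * s)) (cong (i *_) (trans (sym (+-identityʳ s)) s+0≡n))
    letter t@(suc _) s+t≡n i = mk⇔
      (small⇒negResidue s+t≡n i ∘ ascent⇒small s+t≡n i ∘ if-does≡then⇒ lo≢hi ascent?)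
      (if-does≡then⇐ ascent? ∘ small⇒ascent s+t≡n (s≤s z≤n) i ∘ negResidue⇒small s+t≡n i)
      where ascent? = (i * t) % n <? (suc i * t) % n

  christoffel-lo⇔negResidue : s ≤ n → (i : Fin n) →
    lookup (christoffel lo hi n s) i ≡ lo ⇔ NegResidue n s (toℕ i * s)
  christoffel-lo⇔negResidue s≤n i
    rewrite lookup∘tabulate (λ j → christoffelLetter lo hi n (n ∸ s) (toℕ j)) i =
    letter (n ∸ s) (m+[n∸m]≡n s≤n) (toℕ i)

-- Linear congruences with a coprime coefficient.

-- Abstract, since a with-abstraction over its result would normalise the Bézout recursion.
abstract
  coprime⇒∃-negated-multiple : ∀ {m n} .{{_ : NonZero n}} → Coprime m n →
    ∀ c → ∃[ x ] (x < n × n ∣ x * m + c)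
  coprime⇒∃-negated-multiple {m} {n} coprime c = w % n , m%n<n w n , reduced
    where
    unreduced : Bézout.Identity 1 m n → ∃[ w ] n ∣ w * m + c
    unreduced (Bézout.-+ x y 1+xm≡yn) = c * x , divides (c * y) (begin
      c * x * m + c    ≡⟨ regroup c x m ⟩
      c * (1 + x * m)  ≡⟨ cong (c *_) 1+xm≡yn ⟩
      c * (y * n)      ≡⟨ *-assoc c y n ⟨
      c * y * n        ∎)
      where
      open ≡-Reasoning
      regroup : ∀ c x m → c * x * m + c ≡ c * (1 + x * m)
      regroup = solve-∀
    -- In this case `x` inverts `m` mod `n`, and a factor `- c` is needed; `c * k` with `k = n - 1`
    -- represents it without subtraction.
    unreduced (Bézout.+- x y 1+yn≡xm) = c * k * x , divides (c + c * k * y) (begin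
      c * k * x * m + c            ≡⟨ cong (_+ c) (*-assoc (c * k) x m) ⟩
      c * k * (x * m) + c          ≡⟨ cong (λ e → c * k * e + c) 1+yn≡xm ⟨
      c * k * (1 + y * n) + c      ≡⟨ regroup c k y n ⟩
      c * suc k + c * k * y * n    ≡⟨ cong (λ e → c * e + c * k * y * n) (suc-pred n) ⟩
      c * n + c * k * y * n        ≡⟨ *-distribʳ-+ n c (c * k * y) ⟨
      (c + c * k * y) * n          ∎)
      where
      open ≡-Reasoning
      k : ℕ
      k = pred n
      regroup : ∀ c k y n → c * k * (1 + y * n) + c ≡ c * suc k + c * k * y * n
      regroup = solve-∀
    solution : ∃[ w ] n ∣ w * m + c
    solution = unreduced (coprime-Bézout coprime)
    w : ℕ
    w = proj₁ solution
    regroup : ∀ ρ k n m c → (ρ + k * n) * m + c ≡ k * m * n + (ρ * m + c)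
    regroup = solve-∀
    reduced : n ∣ (w % n) * m + c
    reduced = ∣m+n∣m⇒∣n
      (subst (n ∣_) (trans (cong (λ e → e * m + c) (m≡m%n+[m/n]*n w n)) (regroup (w % n) (w / n) n m c))
        (proj₂ solution))
      (n∣m*n (w / n * m))

-- Collisions of lower letters as congruences.

-- Add `β` times the first divisibility to `α` times the second. The sum is
-- `(i + j) * (α * β) + r * β + q * α`; adding `p * α` with `p = β - q` completes `q * α` to
-- `β * α`, and `i + j + 1 = n` turns all but `r * β` into a multiple of `n`. Multiples of `n` on
-- both sides express the congruence in ℕ.
collision⇒congruence : ∀ {n α β i j} → suc (i + j) ≡ n →
  NegResidue n α (i * α) → NegResidue n β (j * β) →
  ∃[ p ] ∃[ r ] ∃[ k ] ∃[ l ] (0 < p × p ≤ β × r < α × p * α + k * n ≡ r * β + l * n)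
collision⇒congruence {n} {α} {β} {i} {j} refl (r , r<α , divides k iα+r≡kn) (q , q<β , divides l jβ+q≡ln) =
  p , r , β * k + α * l , α * β , m<n⇒0<n∸m q<β , m∸n≤m β q , r<α , (begin
    p * α + (β * k + α * l) * n                  ≡⟨ distribute p α β k l n ⟩
    p * α + β * (k * n) + α * (l * n)            ≡⟨ cong₂ (λ x y → p * α + β * x + α * y) iα+r≡kn jβ+q≡ln ⟨
    p * α + β * (i * α + r) + α * (j * β + q)    ≡⟨ regroup p q α β i j r ⟩
    (q + p) * α + r * β + (i + j) * (α * β)      ≡⟨ cong (λ x → x * α + r * β + (i + j) * (α * β)) (m+[n∸m]≡n (<⇒≤ q<β)) ⟩
    β * α + r * β + (i + j) * (α * β)            ≡⟨ collect α β i j r ⟩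
    r * β + α * β * n                            ∎)
  where
  open ≡-Reasoning
  p = β ∸ q
  distribute : ∀ p α β k l n → p * α + (β * k + α * l) * n ≡ p * α + β * (k * n) + α * (l * n)
  distribute = solve-∀
  regroup : ∀ p q α β i j r →
    p * α + β * (i * α + r) + α * (j * β + q) ≡ (q + p) * α + r * β + (i + j) * (α * β)
  regroup = solve-∀
  collect : ∀ α β i j r → β * α + r * β + (i + j) * (α * β) ≡ r * β + α * β * suc (i + j)
  collect = solve-∀

-- Coprimality of `n` and `α` is used twice: to solve `i * α ≡ - r` for the position `i`, and to
-- cancel `α` from `n ∣ α * (j * β + q)`, where `q = β - p`. The latter divisibility is the
-- preceding computation run backwards.
congruence⇒collision : ∀ {n α β p r} c .{{_ : NonZero n}} → Coprime n α → p ≤ β → 0 < p → r < α →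
  p * α ≡ r * β + c * n →
  ∃[ i ] (i < n × (∀ {j} → suc (i + j) ≡ n → NegResidue n α (i * α) × NegResidue n β (j * β)))
congruence⇒collision {n} {α} {β} {p} {r} c coprime p≤β 0<p r<α pα≡rβ+cn
  with coprime⇒∃-negated-multiple (Coprimality.sym coprime) r
... | i , i<n , n∣iα+r = i , i<n , λ {j} 1+i+j≡n →
  (r , r<α , n∣iα+r) , (q , ∸-monoʳ-< 0<p p≤β , coprime-divisor coprime (∣m+n∣m⇒∣n
    (divides (α * β) (total 1+i+j≡n))
    (∣m∣n⇒∣m+n (∣-trans n∣iα+r (m∣m*n β)) (n∣m*n c))))
  where
  q = β ∸ p
  regroup : ∀ α β i j r q cn →
    (i * α + r) * β + cn + α * (j * β + q) ≡ (i + j) * (α * β) + q * α + (r * β + cn)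
  regroup = solve-∀
  collect : ∀ α β m q p → m * (α * β) + q * α + p * α ≡ m * (α * β) + (q + p) * α
  collect = solve-∀
  refold : ∀ α β m → m * (α * β) + β * α ≡ α * β * suc m
  refold = solve-∀
  total : ∀ {j} → suc (i + j) ≡ n → (i * α + r) * β + c * n + α * (j * β + q) ≡ α * β * n
  total {j} 1+i+j≡n = begin
    (i * α + r) * β + c * n + α * (j * β + q)        ≡⟨ regroup α β i j r q (c * n) ⟩
    (i + j) * (α * β) + q * α + (r * β + c * n)      ≡⟨ cong ((i + j) * (α * β) + q * α +_) pα≡rβ+cn ⟨
    (i + j) * (α * β) + q * α + p * α                ≡⟨ collect α β (i + j) q p ⟩
    (i + j) * (α * β) + (q + p) * α                  ≡⟨ cong (λ x → (i + j) * (α * β) + x * α) (m∸n+n≡m p≤β) ⟩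
    (i + j) * (α * β) + β * α                        ≡⟨ refold α β (i + j) ⟩
    α * β * suc (i + j)                              ≡⟨ cong (α * β *_) 1+i+j≡n ⟩
    α * β * n                                        ∎
    where open ≡-Reasoning

-- A positive representation excludes the congruence.

-- When the left side is a multiple of `α`, so is `β * (r + c * y)`, and coprimality then applies to
-- `r + c * y`.
separate-multiple-of-α : ∀ α β x y r c →
  r * β + c * (α * x + β * y) ≡ c * x * α + β * (r + c * y)
separate-multiple-of-α = solve-∀

separate-multiple-of-β : ∀ α β x y p c →
  p * α + c * (α * x + β * y) ≡ c * y * β + α * (p + c * x)
separate-multiple-of-β = solve-∀

module _ {α β x y : ℕ} .{{_ : NonZero α}} .{{_ : NonZero β}}
         (coprime : Coprime α β) (0<x : 0 < x) (0<y : 0 < y) where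

  private
    N = α * x + β * y

  -- Coprimality gives `r + c * y = j * α`, and cancelling `α` gives `p = c * x + j * β`. If
  -- `j = 0`, then `c = 0` makes `p` zero, while `c > 0` contradicts `y > 0`. If `j > 0`, then
  -- `c = 0` makes `r ≥ α`, while `c > 0` makes `p ≥ x + β > β`.
  no-congruence-above : ∀ {p r} c → 0 < p → p ≤ β → r < α → p * α ≢ r * β + c * N
  no-congruence-above {p} {r} c 0<p p≤β r<α pα≡rβ+cN
    with coprime-divisor coprime (∣m+n∣m⇒∣n (divides p (sym (trans pα≡rβ+cN (separate-multiple-of-α α β x y r c)))) (n∣m*n (c * x)))
  ... | divides j r+cy≡jα = absurd j c r+cy≡jα p≡cx+jβ
    where
    merge : ∀ α β c x j → c * x * α + β * (j * α) ≡ (c * x + j * β) * α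
    merge = solve-∀
    p≡cx+jβ : p ≡ c * x + j * β
    p≡cx+jβ = *-cancelʳ-≡ p (c * x + j * β) α (begin
      p * α                        ≡⟨ pα≡rβ+cN ⟩
      r * β + c * N                ≡⟨ separate-multiple-of-α α β x y r c ⟩
      c * x * α + β * (r + c * y)  ≡⟨ cong (λ e → c * x * α + β * e) r+cy≡jα ⟩
      c * x * α + β * (j * α)      ≡⟨ merge α β c x j ⟩
      (c * x + j * β) * α          ∎)
      where open ≡-Reasoning
    absurd : ∀ j c → r + c * y ≡ j * α → p ≡ c * x + j * β → ⊥
    absurd zero    zero    _ p≡0     = <⇒≢ 0<p (sym p≡0)
    absurd zero    (suc c) r+y≡0 _   = <⇒≢ (<-≤-trans 0<y (≤-trans (m≤m+n y (c * y)) (m≤n+m _ r))) (sym r+y≡0)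
    absurd (suc j) zero    r≡α+jα _  =
      <⇒≱ r<α (subst (α ≤_) (trans (sym r≡α+jα) (+-identityʳ r)) (m≤m+n α (j * α)))
    absurd (suc j) (suc c) _ p≡x+β+… = <⇒≱ (subst (β <_) (sym p≡x+β+…)
      (+-mono-<-≤ (<-≤-trans 0<x (m≤m+n x (c * x))) (m≤m+n β (j * β)))) p≤β

  -- With the roles exchanged, `p + c * x = j * β` and `r = c * y + j * α`: `j = 0` contradicts
  -- `p > 0`, and `j > 0` contradicts `r < α`.
  no-congruence-below : ∀ {p r} c → 0 < p → r < α → p * α + c * N ≢ r * β
  no-congruence-below {p} {r} c 0<p r<α pα+cN≡rβ
    with coprime-divisor (Coprimality.sym coprime)
           (∣m+n∣m⇒∣n (divides r (trans (sym (separate-multiple-of-β α β x y p c)) pα+cN≡rβ)) (n∣m*n (c * y)))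
  ... | divides j p+cx≡jβ = absurd j p+cx≡jβ r≡cy+jα
    where
    merge : ∀ α β c y j → c * y * β + α * (j * β) ≡ (c * y + j * α) * β
    merge = solve-∀
    r≡cy+jα : r ≡ c * y + j * α
    r≡cy+jα = *-cancelʳ-≡ r (c * y + j * α) β (begin
      r * β                        ≡⟨ pα+cN≡rβ ⟨
      p * α + c * N                ≡⟨ separate-multiple-of-β α β x y p c ⟩
      c * y * β + α * (p + c * x)  ≡⟨ cong (λ e → c * y * β + α * e) p+cx≡jβ ⟩
      c * y * β + α * (j * β)      ≡⟨ merge α β c y j ⟩
      (c * y + j * α) * β          ∎)
      where open ≡-Reasoning
    absurd : ∀ j → p + c * x ≡ j * β → r ≡ c * y + j * α → ⊥
    absurd zero    p+cx≡0 _        = <⇒≢ (<-≤-trans 0<p (m≤m+n p (c * x))) (sym p+cx≡0)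
    absurd (suc j) _      r≡cy+α+… =
      <⇒≱ r<α (subst (α ≤_) (sym r≡cy+α+…) (≤-trans (m≤m+n α (j * α)) (m≤n+m _ (c * y))))

  -- Cancelling the smaller multiple of `N` leaves one of the two one-sided equations.
  no-congruence : ∀ {p r} k l → 0 < p → p ≤ β → r < α → p * α + k * N ≢ r * β + l * N
  no-congruence {p} {r} k l 0<p p≤β r<α eq with ≤-total k l
  ... | inj₁ k≤l = no-congruence-above (l ∸ k) 0<p p≤β r<α (+-cancelʳ-≡ (k * N) _ _ (begin
    p * α + k * N                    ≡⟨ eq ⟩
    r * β + l * N                    ≡⟨ cong (λ e → r * β + e * N) (m∸n+n≡m k≤l) ⟨
    r * β + (l ∸ k + k) * N          ≡⟨ regroup (r * β) (l ∸ k) k N ⟩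
    r * β + (l ∸ k) * N + k * N      ∎))
    where
    open ≡-Reasoning
    regroup : ∀ w d k n → w + (d + k) * n ≡ w + d * n + k * n
    regroup = solve-∀
  ... | inj₂ l≤k = no-congruence-below (k ∸ l) 0<p r<α (+-cancelʳ-≡ (l * N) _ _ (begin
    p * α + (k ∸ l) * N + l * N      ≡⟨ regroup (p * α) (k ∸ l) l N ⟩
    p * α + (k ∸ l + l) * N          ≡⟨ cong (λ e → p * α + e * N) (m∸n+n≡m l≤k) ⟩
    p * α + k * N                    ≡⟨ eq ⟩
    r * β + l * N                    ∎))
    where
    open ≡-Reasoning
    regroup : ∀ w d k n → w + d * n + k * n ≡ w + (d + k) * n
    regroup = solve-∀

-- Either a positive representation or a congruence.

representation⊎congruence : ∀ n {α β} .{{_ : NonZero n}} .{{_ : NonZero α}} .{{_ : NonZero β}} →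
  (∃[ x ] ∃[ y ] (x > 0 × y > 0 × α * x + β * y ≡ n)) ⊎
  (∃[ p ] ∃[ r ] ∃[ c ] (0 < p × p ≤ β × r < α × p * α ≡ r * β + c * n))
representation⊎congruence n {α} {β} with coprime? α β
... | no ¬coprime = inj₂ (from-gcd (gcd[m,n]∣m α β) (gcd[m,n]∣n α β) (¬coprime ∘ gcd≡1⇒coprime))
  where
  factors : ∀ {m q g} → 0 < m → m ≡ q * g → g ≢ 1 → 0 < q × q < m
  factors {q = zero}  0<m m≡0   _   = contradiction (sym m≡0) (<⇒≢ 0<m)
  factors {q = suc q} {zero}  0<m m≡q*0 _ = contradiction (sym (trans m≡q*0 (*-zeroʳ q))) (<⇒≢ 0<m)
  factors {q = suc q} {suc zero} _ _ g≢1 = contradiction refl g≢1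
  factors {q = suc q} {suc (suc g)} _ m≡qg _ =
    s≤s z≤n , subst (suc q <_) (sym m≡qg) (m<m*n (suc q) (suc (suc g)) (s≤s (s≤s z≤n)))
  swap-factor : ∀ p r g n → p * (r * g) ≡ r * (p * g) + 0 * n
  swap-factor = solve-∀
  from-gcd : ∀ {g} → g ∣ α → g ∣ β → g ≢ 1 →
    ∃[ p ] ∃[ r ] ∃[ c ] (0 < p × p ≤ β × r < α × p * α ≡ r * β + c * n)
  from-gcd {g} (divides r α≡rg) (divides p β≡pg) g≢1
    with factors (>-nonZero⁻¹ α) α≡rg g≢1 | factors (>-nonZero⁻¹ β) β≡pg g≢1
  -- `p` and `r` are the cofactors of `g` in `β` and `α`, so both products equal `p * r * g` and
  -- `c = 0` suffices.
  ... | _ , r<α | 0<p , p<β = p , r , 0 , 0<p , <⇒≤ p<β , r<α ,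
    trans (cong (p *_) α≡rg) (trans (swap-factor p r g n) (cong (λ m → r * m + 0 * n) (sym β≡pg)))
... | yes coprime with coprime⇒∃-negated-multiple coprime n
-- As `x′ * α ≡ - n` mod `β`, the number `x = β - x′` satisfies `x * α ≡ n` and lies between 1 and
-- `β`. The matching coefficient of `β` is `e - α`, whose sign is decided by comparing `α` with `e`.
... | x′ , x′<β , divides e x′α+n≡eβ = by-sign (α <? e)
  where
  x = β ∸ x′
  0<x = m<n⇒0<n∸m x′<β
  open ≡-Reasoning
  xα+eβ≡n+βα : x * α + e * β ≡ n + β * α
  xα+eβ≡n+βα = begin
    x * α + e * β          ≡⟨ cong (x * α +_) x′α+n≡eβ ⟨
    x * α + (x′ * α + n)   ≡⟨ regroup x x′ α n ⟩
    n + (x + x′) * α       ≡⟨ cong (λ m → n + m * α) (m∸n+n≡m (<⇒≤ x′<β)) ⟩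
    n + β * α              ∎
    where
    regroup : ∀ x x′ α n → x * α + (x′ * α + n) ≡ n + (x + x′) * α
    regroup = solve-∀
  by-sign : Dec (α < e) → _
  by-sign (yes α<e) = inj₁ (x , e ∸ α , 0<x , m<n⇒0<n∸m α<e , +-cancelʳ-≡ (β * α) _ _ (begin
    α * x + β * (e ∸ α) + β * α  ≡⟨ regroup α x β (e ∸ α) ⟩
    x * α + (e ∸ α + α) * β      ≡⟨ cong (λ m → x * α + m * β) (m∸n+n≡m (<⇒≤ α<e)) ⟩
    x * α + e * β                ≡⟨ xα+eβ≡n+βα ⟩
    n + β * α                    ∎))
    where
    regroup : ∀ α x β y → α * x + β * y + β * α ≡ x * α + (y + α) * β
    regroup = solve-∀
  by-sign (no α≮e) = inj₂ (x , r , 1 , 0<x , m∸n≤m β x′ , r<α , xα≡rβ+n)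
    where
    r = α ∸ e
    regroup : ∀ n β r e → n + β * (r + e) ≡ r * β + 1 * n + e * β
    regroup = solve-∀
    xα≡rβ+n : x * α ≡ r * β + 1 * n
    xα≡rβ+n = +-cancelʳ-≡ (e * β) _ _ (begin
      x * α + e * β            ≡⟨ xα+eβ≡n+βα ⟩
      n + β * α                ≡⟨ cong (λ m → n + β * m) (m∸n+n≡m (≮⇒≥ α≮e)) ⟨
      n + β * (r + e)          ≡⟨ regroup n β r e ⟩
      r * β + 1 * n + e * β    ∎)
    r<α : r < α
    -- Since `n > 0`, `r * β < r * β + n = x * α ≤ β * α`; then cancel `β`.
    r<α = *-cancelʳ-< β r α (<-≤-trans
      (m<m+n (r * β) (≤-trans (>-nonZero⁻¹ n) (m≤m+n n 0)))
      (≤-trans (≤-reflexive (sym xα≡rβ+n)) (≤-trans (*-monoˡ-≤ α (m∸n≤m β x′)) (≤-reflexive (*-comm β α)))))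

-- Superimposability and positive representations.

theorem5p1 : (n α β : ℕ) .{{_ : NonZero n}} .{{_ : NonZero α}} .{{_ : NonZero β}} →
    α ≤ n → β ≤ n → Coprime n α → Coprime n β →
    (∃[ x ] ∃[ y ] (x > 0 × y > 0 × α * x + β * y ≡ n))
    ⇔ PerfectlySuperimposable (christoffel a z n α) (reverse (christoffel b z n β))
theorem5p1 n α β α≤n β≤n n⊥α n⊥β = mk⇔ to from
  where
  u⇔ : ∀ i → lookup (christoffel a z n α) i ≡ a ⇔ NegResidue n α (toℕ i * α)
  u⇔ = christoffel-lo⇔negResidue (λ ()) (>-nonZero⁻¹ α) α≤n
  v⇔ : ∀ i → lookup (christoffel b z n β) i ≡ b ⇔ NegResidue n β (toℕ i * β)
  v⇔ = christoffel-lo⇔negResidue (λ ()) (>-nonZero⁻¹ β) β≤n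
  ṽ≡v∘opposite : ∀ i → lookup (reverse (christoffel b z n β)) i ≡ lookup (christoffel b z n β) (opposite i)
  ṽ≡v∘opposite = lookup-reverse (christoffel b z n β)

  to : ∃[ x ] ∃[ y ] (x > 0 × y > 0 × α * x + β * y ≡ n) →
    PerfectlySuperimposable (christoffel a z n α) (reverse (christoffel b z n β))
  to (x , y , x>0 , y>0 , αx+βy≡n) i (uᵢ≡a , ṽᵢ≡b) with collision⇒congruence {i = toℕ i} (suc[i+opposite[i]]≡n i)
    (Equivalence.to (u⇔ i) uᵢ≡a)
    (Equivalence.to (v⇔ (opposite i)) (trans (sym (ṽ≡v∘opposite i)) ṽᵢ≡b))
  ... | p , r , k , l , 0<p , p≤β , r<α , eq = no-congruence α⊥β x>0 y>0 k l 0<p p≤β r<α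
    (subst (λ m → p * α + k * m ≡ r * β + l * m) (sym αx+βy≡n) eq)
    where
    -- A common divisor of `α` and `β` divides `α * x + β * y = n`, hence is common to `n` and `α`.
    α⊥β : Coprime α β
    α⊥β (d∣α , d∣β) = n⊥α
      (subst (_ ∣_) αx+βy≡n (∣m∣n⇒∣m+n (∣-trans d∣α (m∣m*n x)) (∣-trans d∣β (m∣m*n y))) , d∣α)

  from : PerfectlySuperimposable (christoffel a z n α) (reverse (christoffel b z n β)) →
    ∃[ x ] ∃[ y ] (x > 0 × y > 0 × α * x + β * y ≡ n)
  from superimposable with representation⊎congruence n {α} {β}
  ... | inj₁ representation = representation
  ... | inj₂ (p , r , c , 0<p , p≤β , r<α , eq) with congruence⇒collision c n⊥α p≤β 0<p r<α eq
  ... | i , i<n , residues = contradiction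
    ( Equivalence.from (u⇔ ı) (proj₁ (residues′ ı toℕı≡i))
    , trans (ṽ≡v∘opposite ı) (Equivalence.from (v⇔ (opposite ı)) (proj₂ (residues′ ı toℕı≡i))))
    (superimposable ı)
    where
    ı = fromℕ< i<n
    toℕı≡i = toℕ-fromℕ< i<n
    -- A variable `k` in place of `ı`, which itself depends on `i`, lets `refl` identify `i` with
    -- `toℕ k`.
    residues′ : ∀ k → toℕ k ≡ i → NegResidue n α (toℕ k * α) × NegResidue n β (toℕ (opposite k) * β)
    residues′ k refl = residues (suc[i+opposite[i]]≡n k)
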